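{- Let $\Omega=\Omega_0\cup\Omega_1$ be an at most unary topological signature and let $X$ be an arbitrary topological space. Then the Polish representation $\Phi_X:\overline{\Omega}_X\mathsf{Fin}_\Omega\to S_{\mathsf M}$ is an isomorphism of topological algebras.
   Context: $\Omega=\biguplus_n\Omega_n$ is a topological signature with $\Omega_n=\emptyset$ for $n\ge2$. A topological $\Omega$-algebra has continuous evaluation maps $\Omega_n\times A^n\to A$. $\mathsf{Fin}_\Omega$ is the class of finite discrete topological $\Omega$-algebras; $\overline{\Omega}_X\mathsf{Fin}_\Omega$ is the free profinite $\Omega$-algebra over the space $X$: a profinite $\Omega$-algebra with a continuous map $\iota:X\to\overline{\Omega}_X\mathsf{Fin}_\Omega$ whose image generates a dense subalgebra, such that every continuous map from $X$ into a member of $\mathsf{Fin}_\Omega$ extends uniquely through $\iota$ to a continuous homomorphism. Let $X\cup\Omega$ be the topological disjoint union of $X$ and the spaces $\Omega_n$, and $\overline{\Omega}_{X\cup\Omega}\mathsf M$ the free profinite monoid over this space (a profinite monoid with continuous map $\eta$ from $X\cup\Omega$ whose image generates a dense submonoid, universal for continuous maps into finite discrete monoids). It is an $\Omega$-algebra via $E_n(w,u_1,\dots,u_n)=\eta(w)u_1\cdots u_n$, and $S_{\mathsf M}$ is the closed $\Omega$-subalgebra generated by $\eta(X)$. The Polish representation $\Phi_X$ is the unique continuous $\Omega$-homomorphism $\overline{\Omega}_X\mathsf{Fin}_\Omega\to S_{\mathsf M}$ with $\Phi_X\circ\iota=\eta|_X$. -}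

module Defs where

open import Level using (Level) renaming (suc to lsuc)
open import Algebra.Structures using (IsMonoid)
open import Data.Fin.Base using (Fin)
open import Data.Nat.Base using (ℕ; zero; suc)
open import Data.Product using (Σ; Σ-syntax; ∃-syntax; _×_; _,_; proj₁; proj₂)
open import Data.Product.Relation.Binary.Pointwise.NonDependent using (×-setoid)
open import Data.Unit.Polymorphic.Base using (⊤; tt)
open import Function.Base using (_∘_)
open import Function.Bundles using (Inverse)
open import Relation.Binary.Bundles using (Setoid)
open import Relation.Binary.Definitions using (_Respects_)
open import Relation.Binary.PropositionalEquality.Core using (_≡_)
import Relation.Binary.Construct.On as On
import Relation.Binary.PropositionalEquality.Properties as ≡
open import Relation.Binary.Structures using (IsPreorder)
open import Relation.Nullary.Negation.Core using (¬_)
open import Relation.Unary using (Pred; _⊆_; _≐_; _∩_; ⋃)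

private
  variable
    ℓ : Level

-- Sets are setoids, so that threads of an inverse limit can be compared
-- pointwise.  Membership in a subset is ℓ-small while points live in
-- Set (lsuc ℓ); thus quantifying over all open sets of a space does not leave
-- Set (lsuc ℓ).  For the same reason `⋃-open` allows families indexed by
-- Set (lsuc ℓ), such as all open sets with a given property, the union being
-- only required to agree with an ℓ-small subset W; with a one-element family
-- it says that openness is invariant under ≐.
record Space (ℓ : Level) : Set (lsuc (lsuc ℓ)) where
  field
    setoid : Setoid (lsuc ℓ) (lsuc ℓ)

  open Setoid setoid public

  field
    IsOpen  : Pred Carrier ℓ → Set (lsuc ℓ)
    resp    : ∀ {U} → IsOpen U → U Respects _≈_
    ⊤-open  : IsOpen (λ _ → ⊤)
    ∩-open  : ∀ {U V} → IsOpen U → IsOpen V → IsOpen (U ∩ V)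
    ⋃-open  : ∀ {I : Set (lsuc ℓ)} (U : I → Pred Carrier ℓ) (W : Pred Carrier ℓ) →
              (∀ i → IsOpen (U i)) → W ≐ ⋃ I U → IsOpen W

  local-open : (W : Pred Carrier ℓ) →
               (∀ x → W x → ∃[ U ] IsOpen U × U x × U ⊆ W) → IsOpen W
  local-open W nbhd = ⋃-open {I = Σ Carrier W}
    (λ (x , x∈W) → proj₁ (nbhd x x∈W)) W
    (λ (x , x∈W) → proj₁ (proj₂ (nbhd x x∈W)))
    ( (λ {x} x∈W → (x , x∈W) , proj₁ (proj₂ (proj₂ (nbhd x x∈W))))
    , (λ ((x , x∈W) , y∈U) → proj₂ (proj₂ (proj₂ (nbhd x x∈W))) y∈U))

∣_∣ : Space ℓ → Set (lsuc ℓ)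
∣ X ∣ = Space.Carrier X

infix 1 _⟶_

record _⟶_ {ℓ} (X Y : Space ℓ) : Set (lsuc ℓ) where
  private
    module X = Space X
    module Y = Space Y
  field
    to         : X.Carrier → Y.Carrier
    cong       : ∀ {x y} → x X.≈ y → to x Y.≈ to y
    continuous : ∀ {V} → Y.IsOpen V → X.IsOpen (V ∘ to)

open _⟶_ public

idᶜ : (X : Space ℓ) → X ⟶ X
idᶜ X = record { to = λ x → x ; cong = λ p → p ; continuous = λ o → o }

infixr 9 _∘ᶜ_

_∘ᶜ_ : {X Y Z : Space ℓ} → Y ⟶ Z → X ⟶ Y → X ⟶ Z
g ∘ᶜ f = record
  { to         = to g ∘ to f
  ; cong       = cong g ∘ cong f
  ; continuous = continuous f ∘ continuous g
  }

IsDiscrete : Space ℓ → Set (lsuc ℓ)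
IsDiscrete X = ∀ U → U Respects Space._≈_ X → Space.IsOpen X U

IsFinite : Space ℓ → Set (lsuc ℓ)
IsFinite X = ∃[ n ] Inverse (Space.setoid X) (≡.setoid (Fin n))

FiniteDiscrete : Space ℓ → Set (lsuc ℓ)
FiniteDiscrete X = IsFinite X × IsDiscrete X

closure : (X : Space ℓ) → Pred ∣ X ∣ (lsuc ℓ) → Pred ∣ X ∣ (lsuc ℓ)
closure X P x = ∀ U → Space.IsOpen X U → U x → ∃[ y ] U y × P y

IsClosed : (X : Space ℓ) → Pred ∣ X ∣ (lsuc ℓ) → Set (lsuc ℓ)
IsClosed X P = closure X P ⊆ P

IsDense : (X : Space ℓ) → Pred ∣ X ∣ (lsuc ℓ) → Set (lsuc ℓ)
IsDense X P = ∀ U → Space.IsOpen X U → (∃[ x ] U x) → ∃[ y ] U y × P y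

module _ (S : Setoid (lsuc ℓ) (lsuc ℓ))
         {J : Set (lsuc ℓ)} (B : J → Pred (Setoid.Carrier S) ℓ)
         (B-resp : ∀ j → B j Respects Setoid._≈_ S)
         (cover  : ∀ x → ∃[ j ] B j x)
         (refine : ∀ j k x → B j x → B k x → ∃[ l ] B l x × B l ⊆ B j ∩ B k)
         where

  fromBase : Space ℓ
  fromBase = record
    { setoid = S
    ; IsOpen = λ W → ∀ x → W x → ∃[ j ] B j x × B j ⊆ W
    ; resp   = λ W-open {x} {y} x≈y x∈W →
        let j , x∈B , B⊆W = W-open x x∈W in B⊆W (B-resp j x≈y x∈B)
    ; ⊤-open = λ x _ → let j , x∈B = cover x in j , x∈B , (λ _ → tt)
    ; ∩-open = λ U-open V-open x (x∈U , x∈V) →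
        let j , x∈Bⱼ , Bⱼ⊆U = U-open x x∈U
            k , x∈Bₖ , Bₖ⊆V = V-open x x∈V
            l , x∈Bₗ , Bₗ⊆  = refine j k x x∈Bⱼ x∈Bₖ
        in l , x∈Bₗ , (λ y∈ → Bⱼ⊆U (proj₁ (Bₗ⊆ y∈)) , Bₖ⊆V (proj₂ (Bₗ⊆ y∈)))
    ; ⋃-open = λ U W U-open (W⊆ , ⊆W) x x∈W →
        let i , x∈Uᵢ = W⊆ x∈W
            j , x∈B , B⊆Uᵢ = U-open i x x∈Uᵢ
        in j , x∈B , (λ y∈ → ⊆W (i , B⊆Uᵢ y∈))
    }

infixr 2 _⊗_

_⊗_ : Space ℓ → Space ℓ → Space ℓ
_⊗_ {ℓ} X Y = fromBase (×-setoid X.setoid Y.setoid)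
  {J = (∃[ U ] X.IsOpen U) × (∃[ V ] Y.IsOpen V)}
  (λ ((U , _) , (V , _)) (x , y) → U x × V y)
  (λ ((_ , o) , (_ , o′)) (p , q) (x∈U , y∈V) → X.resp o p x∈U , Y.resp o′ q y∈V)
  (λ _ → ((_ , X.⊤-open) , (_ , Y.⊤-open)) , (tt , tt))
  (λ ((_ , o₁) , (_ , o₁′)) ((_ , o₂) , (_ , o₂′)) _ (a , b) (c , d) →
      ((_ , X.∩-open o₁ o₂) , (_ , Y.∩-open o₁′ o₂′)) , ((a , c) , (b , d)) ,
      (λ ((a , c) , (b , d)) → (a , b) , (c , d)))
  where
  module X = Space X
  module Y = Space Y

point : Space ℓ
point = record
  { setoid = record { Carrier = ⊤ ; _≈_ = λ _ _ → ⊤ ; isEquivalence = _ }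
  ; IsOpen = λ _ → ⊤
  ; resp   = λ _ _ u → u
  ; ⊤-open = tt
  ; ∩-open = λ _ _ → tt
  ; ⋃-open = λ _ _ _ _ → tt
  }

infixr 8 _^_

_^_ : Space ℓ → ℕ → Space ℓ
X ^ zero  = point
X ^ suc n = X ⊗ (X ^ n)

-- The base consists of the traces on P of the open sets of X.
subspace : (X : Space ℓ) → Pred ∣ X ∣ (lsuc ℓ) → Space ℓ
subspace {ℓ} X P = fromBase (On.setoid {B = Σ X.Carrier P} X.setoid proj₁)
  {J = ∃[ U ] X.IsOpen U}
  (λ (U , _) → U ∘ proj₁)
  (λ (_ , o) → X.resp o)
  (λ _ → (_ , X.⊤-open) , tt)
  (λ (_ , o) (_ , o′) _ a b → (_ , X.∩-open o o′) , (a , b) , (λ p → p))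
  where module X = Space X

inclusion : (X : Space ℓ) (P : Pred ∣ X ∣ (lsuc ℓ)) → subspace X P ⟶ X
inclusion X P = record
  { to         = proj₁
  ; cong       = λ p → p
  ; continuous = λ o _ u → (_ , o) , u , (λ p → p)
  }

corestrict : {X Y : Space ℓ} {P : Pred ∣ Y ∣ (lsuc ℓ)}
             (f : X ⟶ Y) → (∀ x → P (to f x)) → X ⟶ subspace Y P
corestrict {X = X} f f∈P = record
  { to         = λ x → to f x , f∈P x
  ; cong       = cong f
  ; continuous = λ V-open → Space.local-open X _ λ x x∈V →
      let (U , o) , x∈U , U⊆V = V-open _ x∈V
      in U ∘ to f , continuous f o , x∈U , U⊆V
  }

constᶜ : {X Y : Space ℓ} → ∣ Y ∣ → X ⟶ Y
constᶜ {X = X} {Y} y = record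
  { to         = λ _ → y
  ; cong       = λ _ → Space.refl Y
  ; continuous = λ _ → Space.local-open X _ λ _ y∈V →
      _ , Space.⊤-open X , tt , (λ _ → y∈V)
  }

infixr 2 _⊗ᶜ_

_⊗ᶜ_ : {X X′ Y Y′ : Space ℓ} → X ⟶ X′ → Y ⟶ Y′ → X ⊗ Y ⟶ X′ ⊗ Y′
f ⊗ᶜ g = record
  { to         = λ (x , y) → to f x , to g y
  ; cong       = λ (p , q) → cong f p , cong g q
  ; continuous = λ W-open _ w →
      let ((U , o) , (V , o′)) , u , U×V⊆W = W-open _ w
      in ((_ , continuous f o) , (_ , continuous g o′)) , u , (λ p → U×V⊆W p)
  }

infixr 8 _^ᶜ_

_^ᶜ_ : {X Y : Space ℓ} → X ⟶ Y → (n : ℕ) → X ^ n ⟶ Y ^ n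
f ^ᶜ zero  = idᶜ point
f ^ᶜ suc n = f ⊗ᶜ (f ^ᶜ n)

^ᶜ-∘ : {X Y Z : Space ℓ} (g : Y ⟶ Z) (f : X ⟶ Y) (h : X ⟶ Z) →
       (∀ x → Space._≈_ Z (to g (to f x)) (to h x)) →
       ∀ n xs → Space._≈_ (Z ^ n) (to (g ^ᶜ n) (to (f ^ᶜ n) xs)) (to (h ^ᶜ n) xs)
^ᶜ-∘ g f h gf≈h zero    _        = tt
^ᶜ-∘ g f h gf≈h (suc n) (x , xs) = gf≈h x , ^ᶜ-∘ g f h gf≈h n xs

data AllPow {ℓ} (X : Space ℓ) (P : Pred ∣ X ∣ (lsuc ℓ)) :
            (n : ℕ) → Pred ∣ X ^ n ∣ (lsuc ℓ) where
  []  : AllPow X P zero tt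
  _∷_ : ∀ {n x xs} → P x → AllPow X P n xs → AllPow X P (suc n) (x , xs)

record DirectedSet (ℓ : Level) : Set (lsuc (lsuc ℓ)) where
  field
    Index      : Set (lsuc ℓ)
    _≤_        : Index → Index → Set (lsuc ℓ)
    isPreorder : IsPreorder _≡_ _≤_
    inhabited  : Index
    directed   : ∀ i j → ∃[ k ] i ≤ k × j ≤ k

module _ (I : DirectedSet ℓ)
         (X : DirectedSet.Index I → Space ℓ)
         (bond : ∀ {i j} → DirectedSet._≤_ I i j → X j ⟶ X i) where

  open DirectedSet I

  record IsInverseSystem : Set (lsuc ℓ) where
    field
      bond-id   : ∀ {i} (p : i ≤ i) x → Space._≈_ (X i) (to (bond p) x) x
      bond-comp : ∀ {i j k} (p : i ≤ j) (q : j ≤ k) (r : i ≤ k) x →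
                  Space._≈_ (X i) (to (bond p) (to (bond q) x)) (to (bond r) x)

  -- The canonical map from L to the space of threads, a subspace of the product
  -- of the X i, is a bijection and a homeomorphism: since I is directed, the
  -- preimages of open sets under single projections already form a base of the
  -- topology of the space of threads.
  record IsInverseLimit (L : Space ℓ) (π : ∀ i → L ⟶ X i) : Set (lsuc ℓ) where
    private module L = Space L
    field
      compatible : ∀ {i j} (p : i ≤ j) x →
                   Space._≈_ (X i) (to (bond p) (to (π j) x)) (to (π i) x)
      injective  : ∀ x y → (∀ i → Space._≈_ (X i) (to (π i) x) (to (π i) y)) → x L.≈ y
      surjective : (t : ∀ i → ∣ X i ∣) →
                   (∀ {i j} (p : i ≤ j) → Space._≈_ (X i) (to (bond p) (t j)) (t i)) →
                   ∃[ x ] ∀ i → Space._≈_ (X i) (to (π i) x) (t i)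
      initial    : ∀ U → L.IsOpen U → ∀ x → U x →
                   ∃[ i ] ∃[ V ] Space.IsOpen (X i) V × V (to (π i) x) × V ∘ to (π i) ⊆ U

Signature : (ℓ : Level) → Set (lsuc (lsuc ℓ))
Signature ℓ = ℕ → Space ℓ

AtMostUnary : Signature ℓ → Set (lsuc ℓ)
AtMostUnary Ω = ∀ n → ¬ ∣ Ω (suc (suc n)) ∣

record TopAlgebra {ℓ} (Ω : Signature ℓ) : Set (lsuc (lsuc ℓ)) where
  field
    space : Space ℓ
    eval  : ∀ n → Ω n ⊗ (space ^ n) ⟶ space

  open Space space public

  op : ∀ n → ∣ Ω n ∣ → ∣ space ^ n ∣ → Carrier
  op n w us = to (eval n) (w , us)

module _ {Ω : Signature ℓ} where

  record Hom (A B : TopAlgebra Ω) : Set (lsuc ℓ) where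
    private
      module A = TopAlgebra A
      module B = TopAlgebra B
    field
      map  : A.space ⟶ B.space
      homo : ∀ n w us → to map (A.op n w us) B.≈ B.op n w (to (map ^ᶜ n) us)

    ap : A.Carrier → B.Carrier
    ap = to map

  infixr 9 _∘ʰ_

  _∘ʰ_ : {A B C : TopAlgebra Ω} → Hom B C → Hom A B → Hom A C
  _∘ʰ_ {A} {B} {C} g f = record
    { map  = G.map ∘ᶜ F.map
    ; homo = λ n w us → C.trans (cong G.map (F.homo n w us))
        (C.trans (G.homo n w _)
          (cong (C.eval n)
            ( Space.refl (Ω n)
            , ^ᶜ-∘ G.map F.map (G.map ∘ᶜ F.map) (λ _ → C.refl) n us)))
    }
    where
    module C = TopAlgebra C
    module F = Hom f
    module G = Hom g

  record IsIsomorphism {A B : TopAlgebra Ω} (h : Hom A B) : Set (lsuc ℓ) where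
    private
      module A = TopAlgebra A
      module B = TopAlgebra B
    field
      inverse  : Hom B A
      inverseˡ : ∀ b → Hom.ap h (Hom.ap inverse b) B.≈ b
      inverseʳ : ∀ a → Hom.ap inverse (Hom.ap h a) A.≈ a

  FinΩ : TopAlgebra Ω → Set (lsuc ℓ)
  FinΩ A = FiniteDiscrete (TopAlgebra.space A)

  record IsProfinite (A : TopAlgebra Ω) : Set (lsuc (lsuc ℓ)) where
    field
      I : DirectedSet ℓ

    open DirectedSet I public

    field
      quotient  : Index → TopAlgebra Ω
      finite    : ∀ i → FinΩ (quotient i)
      bond      : ∀ {i j} → i ≤ j → Hom (quotient j) (quotient i)
      isSystem  : IsInverseSystem I (TopAlgebra.space ∘ quotient) (Hom.map ∘ bond)
      π         : ∀ i → Hom A (quotient i)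
      isLimit   : IsInverseLimit I (TopAlgebra.space ∘ quotient) (Hom.map ∘ bond)
                    (TopAlgebra.space A) (Hom.map ∘ π)

    open IsInverseSystem isSystem public
    open IsInverseLimit isLimit public

  module _ (A : TopAlgebra Ω) where

    open TopAlgebra A

    IsSubalgebra : Pred Carrier (lsuc ℓ) → Set (lsuc ℓ)
    IsSubalgebra P = ∀ n w us → AllPow space P n us → P (op n w us)

    data Generated {X : Space ℓ} (f : X ⟶ space) : Pred Carrier (lsuc ℓ) where
      gen : ∀ x → Generated f (to f x)
      app : ∀ n w us → AllPow space (Generated f) n us → Generated f (op n w us)
      ≈-resp : ∀ {a b} → a ≈ b → Generated f a → Generated f b

    members : ∀ {P} n (us : ∣ subspace space P ^ n ∣) →
              AllPow space P n (to (inclusion space P ^ᶜ n) us)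
    members zero    _              = []
    members (suc n) ((_ , p) , us) = p ∷ members n us

    subalgebra : (P : Pred Carrier (lsuc ℓ)) → IsSubalgebra P → TopAlgebra Ω
    subalgebra P sub = record
      { space = subspace space P
      ; eval  = λ n → corestrict
          (eval n ∘ᶜ (idᶜ (Ω n) ⊗ᶜ (inclusion space P ^ᶜ n)))
          (λ (w , us) → sub n w _ (members n us))
      }

    inclusionHom : ∀ {P} (sub : IsSubalgebra P) → Hom (subalgebra P sub) A
    inclusionHom {P} sub = record { map = inclusion space P ; homo = λ _ _ _ → refl }

    corestrictHom : ∀ {P} (sub : IsSubalgebra P) {B : TopAlgebra Ω} (h : Hom B A) →
                    (∀ b → P (Hom.ap h b)) → Hom B (subalgebra P sub)
    corestrictHom {P} _ h h∈P = record
      { map  = corestrict (Hom.map h) h∈P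
      ; homo = λ n w us → trans (Hom.homo h n w us) (cong (eval n)
          ( Space.refl (Ω n)
          , Space.sym (space ^ n)
              (^ᶜ-∘ (inclusion space P) (corestrict (Hom.map h) h∈P) (Hom.map h) (λ _ → refl) n us)))
      }

    closure-isSubalgebra : ∀ {P} → IsSubalgebra P → IsSubalgebra (closure space P)
    closure-isSubalgebra {P} sub n w us us∈ U U-open x∈U =
      let ((_ , _) , (V , V-open)) , (w∈ , us∈V) , box⊆ = continuous (eval n) U-open (w , us) x∈U
          vs , vs∈V , vs∈P = approximate n us us∈ V V-open us∈V
      in op n w vs , box⊆ (w∈ , vs∈V) , sub n w vs vs∈P
      where
      approximate : ∀ n us → AllPow space (closure space P) n us →
                    ∀ W → Space.IsOpen (space ^ n) W → W us →
                    ∃[ vs ] W vs × AllPow space P n vs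
      approximate zero    _ []       W _      us∈W = tt , us∈W , []
      approximate (suc n) _ (c ∷ cs) W W-open us∈W =
        let ((U , o) , (V , o′)) , (u∈ , us∈) , box⊆W = W-open _ us∈W
            v  , v∈U  , v∈P  = c U o u∈
            vs , vs∈V , vs∈P = approximate n _ cs V o′ us∈
        in (v , vs) , box⊆W (v∈U , vs∈V) , v∈P ∷ vs∈P

    closedGenerated : {X : Space ℓ} → X ⟶ space → Pred Carrier (lsuc ℓ)
    closedGenerated f = closure space (Generated f)

    closedSubalgebra : {X : Space ℓ} → X ⟶ space → TopAlgebra Ω
    closedSubalgebra f =
      subalgebra (closedGenerated f) (closure-isSubalgebra app)

    -- `closedGenerated f` is the least closed subalgebra containing the image of f.

    module _ {X : Space ℓ} (f : X ⟶ space) where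

      closedGenerated-image : ∀ x → closedGenerated f (to f x)
      closedGenerated-image x U _ x∈U = to f x , x∈U , gen x

      closedGenerated-isClosed : IsClosed space (closedGenerated f)
      closedGenerated-isClosed c U U-open x∈U =
        let y , y∈U , y∈cl = c U U-open x∈U in y∈cl U U-open y∈U

      closedGenerated-least :
        ∀ {C} → IsClosed space C → IsSubalgebra C → C Respects _≈_ →
        (∀ x → C (to f x)) → closedGenerated f ⊆ C
      closedGenerated-least {C} closed sub C-resp f∈C c = closed λ U U-open x∈U →
        let y , y∈U , g = c U U-open x∈U in y , y∈U , generated g
        where
        generated : Generated f ⊆ C
        generateds : ∀ {n us} → AllPow space (Generated f) n us → AllPow space C n us
        generated (gen x)          = f∈C x
        generated (app n w us all) = sub n w us (generateds all)
        generated (≈-resp p g)     = C-resp p (generated g)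
        generateds []       = []
        generateds (g ∷ gs) = generated g ∷ generateds gs

record FreeProfiniteAlgebra {ℓ} (Ω : Signature ℓ) (X : Space ℓ) : Set (lsuc (lsuc ℓ)) where
  field
    algebra : TopAlgebra Ω

  open TopAlgebra algebra public

  field
    isProfinite   : IsProfinite algebra
    ι             : X ⟶ space
    dense         : IsDense space (Generated algebra ι)
    extend        : (A : TopAlgebra Ω) → FinΩ A → X ⟶ TopAlgebra.space A → Hom algebra A
    extend-ι      : ∀ A (fin : FinΩ A) f x →
                    TopAlgebra._≈_ A (Hom.ap (extend A fin f) (to ι x)) (to f x)
    extend-unique : ∀ A (fin : FinΩ A) f (h : Hom algebra A) →
                    (∀ x → TopAlgebra._≈_ A (Hom.ap h (to ι x)) (to f x)) →
                    ∀ a → TopAlgebra._≈_ A (Hom.ap h a) (Hom.ap (extend A fin f) a)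

record TopMonoid (ℓ : Level) : Set (lsuc (lsuc ℓ)) where
  field
    space : Space ℓ

  open Space space public
    using (Carrier; _≈_; IsOpen; resp; ⊤-open; ∩-open; ⋃-open; local-open)

  field
    mul : space ⊗ space ⟶ space
    ε   : Carrier

  infixl 7 _∙_

  _∙_ : Carrier → Carrier → Carrier
  x ∙ y = to mul (x , y)

  field
    isMonoid : IsMonoid _≈_ _∙_ ε

  open IsMonoid isMonoid public

record MonoidHom {ℓ} (M N : TopMonoid ℓ) : Set (lsuc ℓ) where
  private
    module M = TopMonoid M
    module N = TopMonoid N
  field
    map    : M.space ⟶ N.space
    homo   : ∀ x y → to map (x M.∙ y) N.≈ to map x N.∙ to map y
    ε-homo : to map M.ε N.≈ N.ε

  ap : M.Carrier → N.Carrier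
  ap = to map

FinM : TopMonoid ℓ → Set (lsuc ℓ)
FinM M = FiniteDiscrete (TopMonoid.space M)

record IsProfiniteMonoid {ℓ} (M : TopMonoid ℓ) : Set (lsuc (lsuc ℓ)) where
  field
    I : DirectedSet ℓ

  open DirectedSet I public

  field
    quotient : Index → TopMonoid ℓ
    finite   : ∀ i → FinM (quotient i)
    bond     : ∀ {i j} → i ≤ j → MonoidHom (quotient j) (quotient i)
    isSystem : IsInverseSystem I (TopMonoid.space ∘ quotient) (MonoidHom.map ∘ bond)
    π        : ∀ i → MonoidHom M (quotient i)
    isLimit  : IsInverseLimit I (TopMonoid.space ∘ quotient) (MonoidHom.map ∘ bond)
                 (TopMonoid.space M) (MonoidHom.map ∘ π)

  open IsInverseSystem isSystem public
  open IsInverseLimit isLimit public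

module _ (M : TopMonoid ℓ) where

  open TopMonoid M

  data GeneratedMonoid {Y : Space ℓ} (f : Y ⟶ space) : Pred Carrier (lsuc ℓ) where
    gen    : ∀ y → GeneratedMonoid f (to f y)
    unit   : GeneratedMonoid f ε
    mult   : ∀ {a b} → GeneratedMonoid f a → GeneratedMonoid f b →
             GeneratedMonoid f (a ∙ b)
    ≈-resp : ∀ {a b} → a ≈ b → GeneratedMonoid f a → GeneratedMonoid f b

  product : (n : ℕ) → space ^ n ⟶ space
  product zero    = constᶜ ε
  product (suc n) = mul ∘ᶜ (idᶜ space ⊗ᶜ product n)

record FreeProfiniteMonoid {ℓ} (Y : Space ℓ) : Set (lsuc (lsuc ℓ)) where
  field
    monoid : TopMonoid ℓ

  open TopMonoid monoid public

  field
    isProfinite   : IsProfiniteMonoid monoid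
    η             : Y ⟶ space
    dense         : IsDense space (GeneratedMonoid monoid η)
    extend        : (N : TopMonoid ℓ) → FinM N → Y ⟶ TopMonoid.space N → MonoidHom monoid N
    extend-η      : ∀ N (fin : FinM N) f y →
                    TopMonoid._≈_ N (MonoidHom.ap (extend N fin f) (to η y)) (to f y)
    extend-unique : ∀ N (fin : FinM N) f (h : MonoidHom monoid N) →
                    (∀ y → TopMonoid._≈_ N (MonoidHom.ap h (to η y)) (to f y)) →
                    ∀ a → TopMonoid._≈_ N (MonoidHom.ap h a) (MonoidHom.ap (extend N fin f) a)

module _ (X : Space ℓ) (Ω : Signature ℓ) where

  data Letter : Set (lsuc ℓ) where
    var : ∣ X ∣ → Letter
    sig : ∀ n → ∣ Ω n ∣ → Letter

  data _≈ᴸ_ : Letter → Letter → Set (lsuc ℓ) where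
    var : ∀ {x y} → Space._≈_ X x y → var x ≈ᴸ var y
    sig : ∀ {n w v} → Space._≈_ (Ω n) w v → sig n w ≈ᴸ sig n v

  infixr 5 _∪ᵗ_

  _∪ᵗ_ : Space ℓ
  _∪ᵗ_ = record
    { setoid = record
      { Carrier       = Letter
      ; _≈_           = _≈ᴸ_
      ; isEquivalence = record
        { refl  = λ { {var x} → var X.refl ; {sig n w} → sig (Ω.refl n) }
        ; sym   = λ { (var p) → var (X.sym p) ; (sig p) → sig (Ω.sym _ p) }
        ; trans = λ { (var p) (var q) → var (X.trans p q)
                    ; (sig p) (sig q) → sig (Ω.trans _ p q) }
        }
      }
    ; IsOpen = λ U → X.IsOpen (U ∘ var) × (∀ n → Ω.IsOpen n (U ∘ sig n))
    ; resp   = λ { (o , _) (var p) → X.resp o p ; (_ , o) (sig p) → Ω.resp _ (o _) p }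
    ; ⊤-open = X.⊤-open , Ω.⊤-open
    ; ∩-open = λ (o , os) (o′ , os′) →
        X.∩-open o o′ , (λ n → Ω.∩-open n (os n) (os′ n))
    ; ⋃-open = λ U W os (W⊆ , ⊆W) →
          X.⋃-open _ _ (proj₁ ∘ os) ((λ p → W⊆ p) , (λ p → ⊆W p))
        , (λ n → Ω.⋃-open n _ _ (λ i → proj₂ (os i) n) ((λ p → W⊆ p) , (λ p → ⊆W p)))
    }
    where
    module X = Space X
    module Ω n = Space (Ω n)

module _ {X : Space ℓ} {Ω : Signature ℓ} where

  varᶜ : X ⟶ X ∪ᵗ Ω
  varᶜ = record { to = var ; cong = var ; continuous = proj₁ }

  sigᶜ : ∀ n → Ω n ⟶ X ∪ᵗ Ω
  sigᶜ n = record { to = sig n ; cong = sig ; continuous = λ o → proj₂ o n }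

  -- E n (w , u₁ , … , uₙ) = f w ∙ (u₁ ∙ (… ∙ (uₙ ∙ ε)))
  monoidAlgebra : (M : TopMonoid ℓ) → X ∪ᵗ Ω ⟶ TopMonoid.space M → TopAlgebra Ω
  monoidAlgebra M f = record
    { space = TopMonoid.space M
    ; eval  = λ n → TopMonoid.mul M ∘ᶜ ((f ∘ᶜ sigᶜ n) ⊗ᶜ product M n)
    }

  monoidAlgebraHom : {M N : TopMonoid ℓ} (h : MonoidHom M N)
                     (f : X ∪ᵗ Ω ⟶ TopMonoid.space M) (g : X ∪ᵗ Ω ⟶ TopMonoid.space N) →
                     (∀ y → TopMonoid._≈_ N (MonoidHom.ap h (to f y)) (to g y)) →
                     Hom (monoidAlgebra M f) (monoidAlgebra N g)
  monoidAlgebraHom {M} {N} h f g hf≈g = record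
    { map  = H.map
    ; homo = λ n w us → N.trans (H.homo _ _) (N.∙-cong (hf≈g (sig n w)) (homo-product n us))
    }
    where
    module N = TopMonoid N
    module H = MonoidHom h

    homo-product : ∀ n us → H.ap (to (product M n) us) N.≈ to (product N n) (to (H.map ^ᶜ n) us)
    homo-product zero    _        = H.ε-homo
    homo-product (suc n) (_ , us) = N.trans (H.homo _ _) (N.∙-cong N.refl (homo-product n us))

module _ {Ω : Signature ℓ} {X : Space ℓ}
         (F : FreeProfiniteAlgebra Ω X) (M : FreeProfiniteMonoid (X ∪ᵗ Ω)) where

  private
    module F = FreeProfiniteAlgebra F
    module M = FreeProfiniteMonoid M
    module PM = IsProfiniteMonoid M.isProfinite

  𝓜 : TopAlgebra Ω
  𝓜 = monoidAlgebra M.monoid M.η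

  ηX : X ⟶ M.space
  ηX = M.η ∘ᶜ varᶜ

  S𝓜 : TopAlgebra Ω
  S𝓜 = closedSubalgebra 𝓜 ηX

  record PolishRepresentation : Set (lsuc ℓ) where
    field
      hom   : Hom F.algebra S𝓜
      hom-ι : ∀ x → proj₁ (Hom.ap hom (to F.ι x)) M.≈ to ηX x

  private
    module Q i = TopMonoid (PM.quotient i)

    f : ∀ i → X ∪ᵗ Ω ⟶ Q.space i
    f i = MonoidHom.map (PM.π i) ∘ᶜ M.η

    QΩ : PM.Index → TopAlgebra Ω
    QΩ i = monoidAlgebra (PM.quotient i) (f i)

    πΩ : ∀ i → Hom 𝓜 (QΩ i)
    πΩ i = monoidAlgebraHom (PM.π i) M.η (f i) (λ _ → Q.refl i)

    ext : ∀ i → Hom F.algebra (QΩ i)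
    ext i = F.extend (QΩ i) (PM.finite i) (f i ∘ᶜ varᶜ)

    bondΩ : ∀ {i j} → i PM.≤ j → Hom (QΩ j) (QΩ i)
    bondΩ {i} {j} p = monoidAlgebraHom (PM.bond p) (f j) (f i) (λ y → PM.compatible p (to M.η y))

    ext-compatible : ∀ {i j} (p : i PM.≤ j) a →
                     Q._≈_ i (MonoidHom.ap (PM.bond p) (Hom.ap (ext j) a)) (Hom.ap (ext i) a)
    ext-compatible {i} {j} p = F.extend-unique (QΩ i) (PM.finite i) _ (bondΩ p ∘ʰ ext j) λ x →
      Q.trans i (cong (MonoidHom.map (PM.bond p)) (F.extend-ι (QΩ j) (PM.finite j) _ x))
                (PM.compatible p (to ηX x))

    Φ₀ : F.Carrier → M.Carrier
    Φ₀ a = proj₁ (PM.surjective (λ i → Hom.ap (ext i) a) (λ p → ext-compatible p a))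

    πΦ₀ : ∀ i a → Q._≈_ i (MonoidHom.ap (PM.π i) (Φ₀ a)) (Hom.ap (ext i) a)
    πΦ₀ i a = proj₂ (PM.surjective (λ i → Hom.ap (ext i) a) (λ p → ext-compatible p a)) i

    Φ₁ : F.space ⟶ M.space
    Φ₁ = record
      { to         = Φ₀
      ; cong       = λ {a} {b} a≈b → PM.injective _ _ λ i →
          Q.trans i (πΦ₀ i a) (Q.trans i (cong (Hom.map (ext i)) a≈b) (Q.sym i (πΦ₀ i b)))
      ; continuous = λ {U} U-open → F.local-open _ λ a a∈U →
          let i , V , V-open , a∈V , V⊆U = PM.initial U U-open (Φ₀ a) a∈U
          in V ∘ Hom.ap (ext i) , continuous (Hom.map (ext i)) V-open
           , Q.resp i V-open (πΦ₀ i a) a∈V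
           , (λ {b} b∈V → V⊆U (Q.resp i V-open (Q.sym i (πΦ₀ i b)) b∈V))
      }

    Φ₂ : Hom F.algebra 𝓜
    Φ₂ = record
      { map  = Φ₁
      ; homo = λ n w us → PM.injective _ _ λ i →
          Q.trans i (πΦ₀ i _)
            (Q.trans i (Hom.homo (ext i) n w us)
              (Q.sym i (Q.trans i (Hom.homo (πΩ i) n w _)
                (cong (TopAlgebra.eval (QΩ i) n)
                  ( Space.refl (Ω n)
                  , ^ᶜ-∘ (MonoidHom.map (PM.π i)) Φ₁ (Hom.map (ext i)) (πΦ₀ i) n us)))))
      }

    Φ₂-ι : ∀ x → Φ₀ (to F.ι x) M.≈ to ηX x
    Φ₂-ι x = PM.injective _ _ λ i →
      Q.trans i (πΦ₀ i _) (F.extend-ι (QΩ i) (PM.finite i) _ x)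

    Φ₂-generated : ∀ {a} → Generated F.algebra F.ι a → Generated 𝓜 ηX (Φ₀ a)
    Φ₂-generateds : ∀ {n us} → AllPow F.space (Generated F.algebra F.ι) n us →
                    AllPow M.space (Generated 𝓜 ηX) n (to (Φ₁ ^ᶜ n) us)
    Φ₂-generated (gen x)          = ≈-resp (M.sym (Φ₂-ι x)) (gen x)
    Φ₂-generated (app n w us all) =
      ≈-resp (M.sym (Hom.homo Φ₂ n w us)) (app n w _ (Φ₂-generateds all))
    Φ₂-generated (≈-resp p g)     = ≈-resp (cong Φ₁ p) (Φ₂-generated g)
    Φ₂-generateds []       = []
    Φ₂-generateds (g ∷ gs) = Φ₂-generated g ∷ Φ₂-generateds gs

    Φ₂-closure : ∀ a → closedGenerated 𝓜 ηX (Φ₀ a)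
    Φ₂-closure a U U-open a∈U =
      let b , b∈U , g = F.dense (U ∘ Φ₀) (continuous Φ₁ U-open) (a , a∈U)
      in Φ₀ b , b∈U , Φ₂-generated g

  polish : PolishRepresentation
  polish = record
    { hom   = corestrictHom 𝓜 (closure-isSubalgebra 𝓜 app) Φ₂ Φ₂-closure
    ; hom-ι = Φ₂-ι
    }

  polish-unique : (Φ Ψ : PolishRepresentation) → ∀ a →
                  TopAlgebra._≈_ S𝓜 (Hom.ap (PolishRepresentation.hom Φ) a)
                                    (Hom.ap (PolishRepresentation.hom Ψ) a)
  polish-unique Φ Ψ a = PM.injective _ _ λ i → Q.trans i (projection Φ i) (Q.sym i (projection Ψ i))
    where
    open PolishRepresentation
    projection : (Φ : PolishRepresentation) → ∀ i →
                 Q._≈_ i (MonoidHom.ap (PM.π i) (proj₁ (Hom.ap (hom Φ) a))) (Hom.ap (ext i) a)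
    projection Φ i = F.extend-unique (QΩ i) (PM.finite i) _
      (πΩ i ∘ʰ inclusionHom 𝓜 (closure-isSubalgebra 𝓜 app) ∘ʰ hom Φ)
      (λ x → cong (MonoidHom.map (PM.π i)) (hom-ι Φ x)) a

  Φˣ : Hom F.algebra S𝓜
  Φˣ = PolishRepresentation.hom polish

{-# OPTIONS --safe #-}
-- A finite at most unary algebra A with a continuous map X → A is turned into a
-- finite monoid: the transformations of A, a unary symbol acting as the
-- operation it denotes, and a constant or a variable as the constant map onto
-- its value.  The resulting continuous homomorphism from the free profinite
-- monoid sends the Polish representation of a to the constant map onto the image
-- of a in A, so Φ separates the points of the free profinite algebra.
-- For s in S_M, the terms whose representations are close to s have, in each
-- finite quotient, eventually a common value; these values form a thread, whose
-- limit is the preimage of s.  The thread depends continuously on s.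
module Submission where

open import Level using (Level; Lift; lift) renaming (suc to lsuc)
open import Defs
import Algebra.Construct.Flip.Op as Flip
open import Data.Empty using (⊥-elim)
open import Data.Fin.Base using (Fin; zero; suc; funToFin; finToFun)
open import Data.Fin.Properties using (funToFin-finToFin; finToFun-funToFin)
open import Data.Nat.Base using (ℕ; zero; suc)
open import Data.Product using (∃-syntax; _,_; proj₁; proj₂)
open import Data.Unit.Polymorphic.Base using (tt)
open import Function.Base using (_∘_)
open import Function.Bundles using (Func; Inverse)
import Function.Construct.Composition as Composition
import Function.Construct.Constant as Constant
import Function.Construct.Identity as Identity
open import Function.Endo.Setoid using (∘-id-isMonoid)
open import Function.Relation.Binary.Setoid.Equality using (_⇨_)
open import Relation.Binary.Bundles using (Setoid)
open import Relation.Binary.Definitions using (_Respects_)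
open import Relation.Binary.PropositionalEquality using (_≡_; _≗_)
import Relation.Binary.PropositionalEquality as ≡
open import Relation.Unary using (Pred; ⋂)

private
  variable
    ℓ : Level

-- Finite intersections of open sets, discrete spaces and finite discrete spaces.

⋂-open : (X : Space ℓ) {n : ℕ} (U : Fin n → Pred ∣ X ∣ ℓ) →
         (∀ i → Space.IsOpen X (U i)) → Space.IsOpen X (⋂ (Fin n) U)
⋂-open X {zero}  U os = Space.local-open X _ λ x _ →
  _ , Space.⊤-open X , tt , λ _ ()
⋂-open X {suc n} U os = Space.local-open X _ λ x x∈ →
  _ , Space.∩-open X (os zero) (⋂-open X (U ∘ suc) (os ∘ suc)) , (x∈ zero , x∈ ∘ suc) ,
  λ { (y∈ , ys∈) zero → y∈ ; (y∈ , ys∈) (suc i) → ys∈ i }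

discrete : Setoid (lsuc ℓ) (lsuc ℓ) → Space ℓ
discrete S = record
  { setoid = S
  ; IsOpen = λ U → U Respects _≈_
  ; resp   = λ o → o
  ; ⊤-open = λ _ _ → tt
  ; ∩-open = λ o o′ p (u , v) → o p u , o′ p v
  ; ⋃-open = λ U W os (W⊆ , ⊆W) p w → let i , u = W⊆ w in ⊆W (i , os i p u)
  }
  where open Setoid S

discreteᶜ : {X Y : Space ℓ} → IsDiscrete X → Func (Space.setoid X) (Space.setoid Y) → X ⟶ Y
discreteᶜ {Y = Y} disc f = record
  { to         = Func.to f
  ; cong       = Func.cong f
  ; continuous = λ V-open → disc _ (λ p → Space.resp Y V-open (Func.cong f p))
  }

module FiniteSpace (X : Space ℓ) (fin : FiniteDiscrete X) where

  open Space X
  open Inverse (proj₂ (proj₁ fin)) public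
    using () renaming (to to code; from to decode; to-cong to code-cong)
  open Inverse (proj₂ (proj₁ fin)) using (strictlyInverseʳ; from-cong)

  size : ℕ
  size = proj₁ (proj₁ fin)

  decode-code : ∀ x → decode (code x) ≈ x
  decode-code = strictlyInverseʳ

  code-injective : ∀ {x y} → code x ≡ code y → x ≈ y
  code-injective {x} {y} p = trans (sym (decode-code x)) (trans (from-cong p) (decode-code y))

  -- The relation x ≈ y is too large to be an open set; equality of codes is not.
  singleton : Carrier → Pred Carrier ℓ
  singleton x y = Lift ℓ (code x ≡ code y)

  singleton-open : ∀ x → IsOpen (singleton x)
  singleton-open x = proj₂ fin _ λ p (lift q) → lift (≡.trans q (code-cong p))

  singleton-refl : ∀ {x} → singleton x x
  singleton-refl = lift ≡.refl

  singleton⇒≈ : ∀ {x y} → singleton x y → x ≈ y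
  singleton⇒≈ (lift p) = code-injective p

-- Boxes of singletons are basic open sets of the product. This makes the multiplication of a finite
-- discrete monoid continuous.
⊗-discrete : (X Y : Space ℓ) → FiniteDiscrete X → FiniteDiscrete Y → IsDiscrete (X ⊗ Y)
⊗-discrete X Y finX finY W W-resp (x , y) xy∈W =
  ((_ , X.singleton-open x) , (_ , Y.singleton-open y)) , (X.singleton-refl , Y.singleton-refl) ,
  λ (p , q) → W-resp (X.singleton⇒≈ p , Y.singleton⇒≈ q) xy∈W
  where
  module X = FiniteSpace X finX
  module Y = FiniteSpace Y finY

-- The finite monoid of transformations of a finite discrete space.

funToFin-cong : ∀ {m n} {f g : Fin m → Fin n} → f ≗ g → funToFin f ≡ funToFin g
funToFin-cong {zero}  f≗g = ≡.refl
funToFin-cong {suc m} f≗g rewrite f≗g zero | funToFin-cong (f≗g ∘ suc) = ≡.refl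

module Transformations (X : Space ℓ) (fin : FiniteDiscrete X) where

  open Space X using (Carrier; setoid; refl; trans)
  open FiniteSpace X fin

  transformations : Space ℓ
  transformations = discrete (setoid ⇨ setoid)

  private
    encode : Func setoid setoid → Fin size → Fin size
    encode f i = code (Func.to f (decode i))

    transform : (Fin size → Fin size) → Func setoid setoid
    transform g = record
      { to   = λ x → decode (g (code x))
      ; cong = λ p → Space.reflexive X (≡.cong (decode ∘ g) (code-cong p))
      }

    encode-cong : ∀ {f g} → Space._≈_ transformations f g → encode f ≗ encode g
    encode-cong f≈g i = code-cong (f≈g (decode i))

    transform-cong : ∀ {f g} → f ≗ g → Space._≈_ transformations (transform f) (transform g)
    transform-cong f≗g x = Space.reflexive X (≡.cong decode (f≗g (code x)))

    encode-transform : ∀ g → encode (transform g) ≗ g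
    encode-transform g i = ≡.trans (code-decode _) (≡.cong g (code-decode i))
      where
      code-decode : ∀ i → code (decode i) ≡ i
      code-decode = Inverse.strictlyInverseˡ (proj₂ (proj₁ fin))

    transform-encode : ∀ f → Space._≈_ transformations (transform (encode f)) f
    transform-encode f x = trans (decode-code _) (Func.cong f (decode-code x))

  -- Read through the numbering of `X`, transformations become self-maps of `Fin size`, which
  -- `funToFin` numbers in turn.
  transformations-finite : FiniteDiscrete transformations
  transformations-finite = (_ , record
    { to        = funToFin ∘ encode
    ; from      = transform ∘ finToFun
    ; to-cong   = λ {f} {g} p → funToFin-cong (encode-cong {f} {g} p)
    ; from-cong = λ { ≡.refl _ → refl }
    ; inverse   =
        (λ {k} {f} p → ≡.trans
          (funToFin-cong (λ i → ≡.trans (encode-cong {f} {transform (finToFun k)} p i)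
                                        (encode-transform (finToFun k) i)))
          (funToFin-finToFin {size} {size} k))
      , (λ { {f} ≡.refl x → trans (transform-cong (finToFun-funToFin (encode f)) x)
                                  (transform-encode f x) })
    }) , λ _ o {x} {y} → o {x} {y}

  monoid : TopMonoid ℓ
  monoid = record
    { space    = transformations
    ; mul      = discreteᶜ {X = transformations ⊗ transformations} {transformations}
                   (⊗-discrete transformations transformations transformations-finite transformations-finite) record
        -- The right factor acts first, so the leading symbol of a Polish word is applied to the
        -- value of the rest of the word.
        { to   = λ (f , g) → Composition.function g f
        ; cong = λ { {f , _} {_ , g′} (p , q) x → trans (Func.cong f (q x)) (p (Func.to g′ x)) }
        }
    ; ε        = Identity.function setoid
    ; isMonoid = Flip.isMonoid (∘-id-isMonoid setoid)
    }

  const : Carrier → Func setoid setoid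
  const a = Constant.function setoid setoid a

-- The action of variables and operation symbols on a finite algebra.

module _ (Ω : Signature ℓ) (unary : AtMostUnary Ω) (A : TopAlgebra Ω) (fin : FinΩ A) where

  private module A = TopAlgebra A

  open FiniteSpace A.space fin
  open Transformations A.space fin

  private
    -- At each point of `A` the result is locally constant in the symbol, because singletons are
    -- open. As `A` is finite, intersecting these neighbourhoods over all points leaves an open set
    -- of symbols with the same action.
    unaryᶜ : Ω 1 ⟶ transformations
    unaryᶜ = record
      { to         = act
      ; cong       = λ p a → cong (A.eval 1) (p , A.refl , tt)
      ; continuous = λ {V} V-open → Space.local-open (Ω 1) _ λ w w∈V →
            ⋂ (Fin size) (agree w)
          , ⋂-open (Ω 1) (agree w) (agree-open w)
          , (λ i → proj₁ (proj₁ (proj₂ (box w i))))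
          , (λ {v} v∈ → V-open {act w} {act v} (agree⇒≈ v∈) w∈V)
      }
      where
      act : ∣ Ω 1 ∣ → Func A.setoid A.setoid
      act w = record
        { to   = λ a → A.op 1 w (a , tt)
        ; cong = λ p → cong (A.eval 1) (Space.refl (Ω 1) , p , tt)
        }

      box : ∀ w i → _
      box w i = continuous (A.eval 1) (singleton-open (A.op 1 w (decode i , tt)))
                  (w , decode i , tt) singleton-refl

      agree : ∣ Ω 1 ∣ → Fin size → Pred ∣ Ω 1 ∣ ℓ
      agree w i = proj₁ (proj₁ (proj₁ (box w i)))

      agree-open : ∀ w i → Space.IsOpen (Ω 1) (agree w i)
      agree-open w i = proj₂ (proj₁ (proj₁ (box w i)))

      agree⇒≈ : ∀ {w v} → ⋂ (Fin size) (agree w) v → Space._≈_ transformations (act w) (act v)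
      agree⇒≈ {w} {v} v∈ a =
        A.trans (Func.cong (act w) (A.sym (decode-code a)))
          (A.trans
            (singleton⇒≈ (proj₂ (proj₂ (box w (code a)))
              (v∈ (code a) , proj₂ (proj₁ (proj₂ (box w (code a)))))))
            (Func.cong (act v) (decode-code a)))

    constᵗ : A.space ⟶ transformations
    constᵗ = discreteᶜ {X = A.space} {transformations} (proj₂ fin) record { to = const ; cong = λ p _ → p }

    nullaryᶜ : Ω 0 ⟶ A.space
    nullaryᶜ = record
      { to         = λ w → A.op 0 w tt
      ; cong       = λ p → cong (A.eval 0) (p , tt)
      ; continuous = λ V-open → Space.local-open (Ω 0) _ λ w w∈V →
          let ((U , o) , _) , (w∈U , tt∈) , U⊆ = continuous (A.eval 0) V-open (w , tt) w∈V
          in U , o , w∈U , (λ v∈U → U⊆ (v∈U , tt∈))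
      }

    symbol : ∀ n → Ω n ⟶ transformations
    symbol zero          = constᵗ ∘ᶜ nullaryᶜ
    symbol (suc zero)    = unaryᶜ
    symbol (suc (suc n)) = record
      { to         = λ w → ⊥-elim (unary n w)
      ; cong       = λ {w} → ⊥-elim (unary n w)
      ; continuous = λ _ → Space.local-open (Ω (suc (suc n))) _ λ w → ⊥-elim (unary n w)
      }

  module _ {X : Space ℓ} (f : X ⟶ A.space) where

    action : X ∪ᵗ Ω ⟶ transformations
    action = record
      { to         = λ { (var x) → to constᵗ (to f x) ; (sig n w) → to (symbol n) w }
      ; cong       = λ { (var p) → cong constᵗ (cong f p)
                       ; {sig n w} {sig .n v} (sig p) → cong (symbol n) {w} {v} p }
      ; continuous = λ {V} o → continuous (constᵗ ∘ᶜ f) {V} o , λ n → continuous (symbol n) {V} o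
      }

    -- The action of a unary symbol after the constant map onto `a` is the constant map onto the
    -- symbol's value at `a`, and a constant map absorbs whatever acts before it. The latter would
    -- lose all arguments but the first in higher arities, which `unary` excludes.
    constHom : Hom A (monoidAlgebra {X = X} monoid action)
    constHom = record
      { map  = constᵗ
      ; homo = λ { zero          w _ _ → A.refl
                 ; (suc zero)    w _ _ → A.refl
                 ; (suc (suc n)) w _   → ⊥-elim (unary n w) }
      }

-- Values of monoid elements in the finite quotients, and injectivity of the representation.

module _ (Ω : Signature ℓ) (unary : AtMostUnary Ω) (X : Space ℓ)
         (F : FreeProfiniteAlgebra Ω X) (M : FreeProfiniteMonoid (X ∪ᵗ Ω))
         (Φ : PolishRepresentation F M) where

  private
    module F  = FreeProfiniteAlgebra F
    module M  = FreeProfiniteMonoid M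
    module PF = IsProfinite F.isProfinite
    module PM = IsProfiniteMonoid M.isProfinite
    module S  = TopAlgebra (S𝓜 F M)
    module A i = TopAlgebra (PF.quotient i)
    module Q k = TopMonoid (PM.quotient k)
    module T i = Transformations (A.space i) (PF.finite i)
    module FT i = FiniteSpace (T.transformations i) (T.transformations-finite i)
    module FQ k = FiniteSpace (Q.space k) (PM.finite k)
    open PolishRepresentation Φ

    π : ∀ i → F.Carrier → ∣ A.space i ∣
    π i = Hom.ap (PF.π i)

    Φʰ : Hom F.algebra (𝓜 F M)
    Φʰ = record
      { map  = inclusion M.space S ∘ᶜ Hom.map hom
      ; homo = λ n w us → M.trans (Hom.homo hom n w us) (cong (TopAlgebra.eval (𝓜 F M) n)
          ( Space.refl (Ω n)
          , ^ᶜ-∘ (inclusion M.space S) (Hom.map hom) (inclusion M.space S ∘ᶜ Hom.map hom)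
              (λ _ → M.refl) n us))
      }
      where S = closedGenerated (𝓜 F M) (ηX F M)

    Φ₀ : F.Carrier → M.Carrier
    Φ₀ = Hom.ap Φʰ

    values : ∀ i → X ⟶ A.space i
    values i = Hom.map (PF.π i) ∘ᶜ F.ι

    act : ∀ i → X ∪ᵗ Ω ⟶ T.transformations i
    act i = action Ω unary (PF.quotient i) (PF.finite i) (values i)

    act-ext : ∀ i → MonoidHom M.monoid (T.monoid i)
    act-ext i = M.extend (T.monoid i) (T.transformations-finite i) (act i)

    act-ext-η : ∀ i y → Space._≈_ (T.transformations i)
                          (MonoidHom.ap (act-ext i) (to M.η y)) (to (act i) y)
    act-ext-η i = M.extend-η (T.monoid i) (T.transformations-finite i) (act i)

    -- A relation rather than a function of `s`, since an arbitrary element of the monoid, such as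
    -- the unit, need not act as a constant map.
    Value : ∀ i → M.Carrier → A.Carrier i → Set (lsuc ℓ)
    Value i s a = Space._≈_ (T.transformations i) (MonoidHom.ap (act-ext i) s) (T.const i a)

    -- A constant map is only known to determine its value once the value is
    -- given: the quotient might be empty.
    Value-unique : ∀ {i s a b} → Value i s a → Value i s b → A._≈_ i a b
    Value-unique {i} {_} {a} p q = A.trans i (A.sym i (p a)) (q a)

    Value-resp : ∀ {i s t a} → Space._≈_ (T.transformations i)
                   (MonoidHom.ap (act-ext i) s) (MonoidHom.ap (act-ext i) t) →
                 Value i t a → Value i s a
    Value-resp {i} p q x = A.trans i (p x) (q x)

    -- Both sides, as functions of `a`, are continuous homomorphisms into the finite algebra of
    -- transformations. They agree on the variables, so uniqueness of extensions identifies them.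
    Φ-Value : ∀ i a → Value i (Φ₀ a) (π i a)
    Φ-Value i a x = A.trans i (F.extend-unique B B-finite (act i ∘ᶜ varᶜ) via-M via-M-ι a x)
                   (A.sym i (F.extend-unique B B-finite (act i ∘ᶜ varᶜ) via-A via-A-ι a x))
      where
      B : TopAlgebra Ω
      B = monoidAlgebra {X = X} (T.monoid i) (act i)

      B-finite : FinΩ B
      B-finite = T.transformations-finite i

      via-M via-A : Hom F.algebra B
      via-M = monoidAlgebraHom (act-ext i) M.η (act i) (act-ext-η i) ∘ʰ Φʰ
      via-A = constHom Ω unary (PF.quotient i) (PF.finite i) (values i) ∘ʰ PF.π i

      via-M-ι : ∀ x → TopAlgebra._≈_ B (Hom.ap via-M (to F.ι x)) (to (act i) (var x))
      via-M-ι x y = A.trans i (cong (MonoidHom.map (act-ext i)) (hom-ι x) y)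
                              (act-ext-η i (var x) y)

      via-A-ι : ∀ x → TopAlgebra._≈_ B (Hom.ap via-A (to F.ι x)) (to (act i) (var x))
      via-A-ι x y = A.refl i

    -- The representation determines every projection `π i a` as its value, and the projections
    -- separate points.
    Φ-injective : ∀ {a b} → Φ₀ a M.≈ Φ₀ b → a F.≈ b
    Φ-injective {a} {b} p = PF.injective a b λ i → Value-unique {i} {Φ₀ a} (Φ-Value i a)
      (Value-resp {i} {Φ₀ a} {Φ₀ b} (cong (MonoidHom.map (act-ext i)) p) (Φ-Value i b))

    -- Approximation of points of the closed subalgebra by representations, and the thread of
    -- values.

    preimage : ∀ {y} → Generated (𝓜 F M) (ηX F M) y → ∃[ b ] Φ₀ b M.≈ y
    preimages : ∀ {n ys} → AllPow M.space (Generated (𝓜 F M) (ηX F M)) n ys →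
                ∃[ bs ] Space._≈_ (M.space ^ n) (to (Hom.map Φʰ ^ᶜ n) bs) ys
    preimage (gen x)         = to F.ι x , hom-ι x
    preimage (app n w _ gs)  =
      let bs , p = preimages gs
      in F.op n w bs , M.trans (Hom.homo Φʰ n w bs)
                               (cong (TopAlgebra.eval (𝓜 F M) n) (Space.refl (Ω n) , p))
    preimage (≈-resp p g)    = let b , q = preimage g in b , M.trans q p
    preimages []       = tt , tt
    preimages (g ∷ gs) =
      let b , p = preimage g ; bs , ps = preimages gs in (b , bs) , (p , ps)

    -- Membership in the closure yields a generated point of `U`, and `preimage` exhibits it as the
    -- representation of some `b`.
    approximate : ∀ (s : S.Carrier) {U} → M.IsOpen U → U (proj₁ s) → ∃[ b ] U (Φ₀ b)
    approximate (_ , s∈) U-open s∈U =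
      let y , y∈U , g = s∈ _ U-open s∈U
          b , p       = preimage g
      in b , M.resp U-open (M.sym p) y∈U

    near : ∀ i → M.Carrier → Pred M.Carrier ℓ
    near i s = FT.singleton i (MonoidHom.ap (act-ext i) s) ∘ MonoidHom.ap (act-ext i)

    near-open : ∀ i s → M.IsOpen (near i s)
    near-open i s = continuous (MonoidHom.map (act-ext i)) {FT.singleton i (MonoidHom.ap (act-ext i) s)}
                      (λ {f} {g} → FT.singleton-open i (MonoidHom.ap (act-ext i) s) {f} {g})

    near-refl : ∀ i s → near i s s
    near-refl i s = FT.singleton-refl i {MonoidHom.ap (act-ext i) s}

    near-Value : ∀ i {s t a} → near i s t → Value i t a → Value i s a
    near-Value i {s} {t} p = Value-resp {i} {s} {t}
      (FT.singleton⇒≈ i {MonoidHom.ap (act-ext i) s} {MonoidHom.ap (act-ext i) t} p)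

    -- The elements acting on the quotient as `s` does form an open neighbourhood of `s`. It
    -- contains some `Φ₀ b`, whose action is constant by `Φ-Value`.
    value : ∀ (s : S.Carrier) i → ∃[ a ] Value i (proj₁ s) a
    value s i = let b , p = approximate s (near-open i (proj₁ s)) (near-refl i (proj₁ s))
                in π i b , near-Value i {proj₁ s} {Φ₀ b} p (Φ-Value i b)

    -- A single `b` whose representation is near `s` for both indices computes both values, and the
    -- projections of `b` are compatible.
    value-compatible : ∀ (s : S.Carrier) {i j} (p : i PF.≤ j) →
                       A._≈_ i (Hom.ap (PF.bond p) (proj₁ (value s j))) (proj₁ (value s i))
    value-compatible s@(m , _) {i} {j} p =
      let b , (q , r) = approximate s (M.∩-open (near-open i m) (near-open j m))
                                      (near-refl i m , near-refl j m)
      in A.trans i (cong (Hom.map (PF.bond p))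
                     (Value-unique {j} {m} (proj₂ (value s j))
                       (near-Value j {m} {Φ₀ b} r (Φ-Value j b))))
           (A.trans i (PF.compatible p b)
             (Value-unique {i} {m} (near-Value i {m} {Φ₀ b} q (Φ-Value i b))
               (proj₂ (value s i))))

    -- The inverse of the Polish representation and its continuity.

    Ψ : S.Carrier → F.Carrier
    Ψ s = proj₁ (PF.surjective (proj₁ ∘ value s) (value-compatible s))

    Ψ-Value : ∀ s i → Value i (proj₁ s) (π i (Ψ s))
    Ψ-Value s i x = A.trans i (proj₂ (value s i) x)
      (A.sym i (proj₂ (PF.surjective (proj₁ ∘ value s) (value-compatible s)) i))

    -- It suffices to compare images in each finite quotient of the monoid, by way of some `b` close
    -- to `Ψ s` in the algebra with `Φ₀ b` close to `s` in the monoid.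
    ΦΨ : ∀ s → Φ₀ (Ψ s) M.≈ proj₁ s
    ΦΨ s@(m , _) = PM.injective _ _ λ k →
      let ρ = PM.π k
          W-open = continuous (MonoidHom.map ρ ∘ᶜ Hom.map Φʰ)
                     (FQ.singleton-open k (MonoidHom.ap ρ (Φ₀ (Ψ s))))
          -- The index `i` is fine enough that every element with the same `i`-th projection as
          -- `Ψ s` has the same image under `ρ` after `Φ₀`.
          i , V , V-open , Ψs∈V , V⊆W = PF.initial _ W-open (Ψ s) (FQ.singleton-refl k)
          -- One condition on `b` fixes its `i`-th projection, the other the image of `Φ₀ b` under
          -- `ρ`.
          b , (p , q) = approximate s
            (M.∩-open (near-open i m)
              (continuous (MonoidHom.map ρ) (FQ.singleton-open k (MonoidHom.ap ρ m))))
            (near-refl i m , FQ.singleton-refl k)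
          πΨs≈πb = Value-unique {i} {m} (Ψ-Value s i)
                     (near-Value i {m} {Φ₀ b} p (Φ-Value i b))
      in Q.trans k (FQ.singleton⇒≈ k (V⊆W (A.resp i V-open πΨs≈πb Ψs∈V)))
                   (Q.sym k (FQ.singleton⇒≈ k q))

    Ψᶜ : S.space ⟶ F.space
    Ψᶜ = record
      { to         = Ψ
      ; cong       = λ {s} {t} p → Φ-injective (M.trans (ΦΨ s) (M.trans p (M.sym (ΦΨ t))))
      ; continuous = λ {U} U-open s Ψs∈U →
          let i , V , V-open , Ψs∈V , V⊆U = PF.initial U U-open (Ψ s) Ψs∈U
          -- Points near `s` have the same `i`-th value as `s`, so `Ψ` sends them into the preimage
          -- of `V`.
          in (near i (proj₁ s) , near-open i (proj₁ s)) , near-refl i (proj₁ s) ,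
             λ {t} p → V⊆U (A.resp i V-open
               (Value-unique {i} {proj₁ s} (Ψ-Value s i)
                 (near-Value i {proj₁ s} {proj₁ t} p (Ψ-Value t i)))
               Ψs∈V)
      }

  polish-isIsomorphism : IsIsomorphism hom
  polish-isIsomorphism = record
    { inverse  = record
      { map  = Ψᶜ
      -- By injectivity it is enough to compare the images of both sides under `hom`, a homomorphism
      -- with right inverse `Ψ`.
      ; homo = λ n w ss → Φ-injective (M.trans (ΦΨ (S.op n w ss)) (M.sym (M.trans
          (Hom.homo hom n w (to (Ψᶜ ^ᶜ n) ss))
          (cong (S.eval n)
            ( Space.refl (Ω n)
            , Space.trans (S.space ^ n)
                (^ᶜ-∘ (Hom.map hom) Ψᶜ (idᶜ S.space) ΦΨ n ss) (^ᶜ-id n ss))))))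
      }
    ; inverseˡ = ΦΨ
    ; inverseʳ = λ a → Φ-injective (ΦΨ (Hom.ap hom a))
    }
    where
    ^ᶜ-id : ∀ n ss → Space._≈_ (S.space ^ n) (to (idᶜ S.space ^ᶜ n) ss) ss
    ^ᶜ-id zero    _        = tt
    ^ᶜ-id (suc n) (s , ss) = M.refl , ^ᶜ-id n ss

theorem4p15 : {ℓ : Level} (Ω : Signature ℓ) → AtMostUnary Ω → (X : Space ℓ) →
    (F : FreeProfiniteAlgebra Ω X) (M : FreeProfiniteMonoid (X ∪ᵗ Ω)) →
    IsIsomorphism (Φˣ F M)
theorem4p15 Ω unary X F M = polish-isIsomorphism Ω unary X F M (polish F M)
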